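{- Let $D_1$ and $D_2$ be two vertex disjoint Hamiltonian digraphs of order $n$ and $m$, respectively, with $n\geq m$; let $d=\gcd(n,m)$; and let $D$ be a strongly connected digraph in $D_1\oplus D_2$. Then at least one of the following assertions holds: (i) $D$ is vertex-pancyclic; (ii) $D$ is pancyclic; or (iii) $D$ is Hamiltonian and it contains a cycle of length $l$ for each integer $l\in \{3,4,\ldots,n+1\}\cup \{n+id \colon i \text{ an integer},\ 0\leq i < m/d\}$.
   Context: Digraphs are finite, without loops or parallel arcs; a pair of opposite arcs $(u,v),(v,u)$ is allowed and forms a cycle of length 2. "Cycle" means directed cycle (no repeated vertices), and its length is its number of arcs. A digraph is Hamiltonian if it has a cycle containing all its vertices. A digraph is strong (strongly connected) if for each pair of different vertices $u,v$ there exist a directed path from $u$ to $v$ and one from $v$ to $u$. A digraph $D$ of order $N\geq 3$ is pancyclic if it contains a cycle of length $l$ for each $l\in\{3,\ldots,N\}$. It is vertex-pancyclic if for each vertex $v$ and each $l\in\{3,\ldots,N\}$ it contains a cycle of length $l$ passing through $v$. Generalized sum: for vertex disjoint digraphs $D_1,D_2$, the set $D_1\oplus D_2$ consists of all digraphs $D$ such that (1) $V(D)=V(D_1)\cup V(D_2)$; (2) for $i=1,2$ the subdigraph of $D$ induced by $V(D_i)$ is $D_i$; (3) for each $u\in V(D_1)$ and $v\in V(D_2)$, exactly one of $(u,v)$, $(v,u)$ is an arc of $D$ (directions being arbitrary). -}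

module Defs where

open import Data.Fin using (Fin; zero; suc; inject₁; fromℕ)
open import Data.Nat using (ℕ; suc; _≤_)
open import Data.Product using (Σ; ∃; _×_)
open import Data.Sum using (_⊎_; inj₁; inj₂)
open import Data.Vec.Functional using (Vector)
open import Function using (_∘_)
open import Function.Bundles using (_↔_; _⇔_; Inverse)
open import Function.Definitions using (Injective)
open import Relation.Binary.Definitions using (Decidable; Irreflexive)
open import Relation.Binary.PropositionalEquality using (_≡_; _≢_)
open import Relation.Nullary using (¬_)

-- There are no parallel arcs: `u ⟶ v` is only ever used as a (decidable)
-- proposition, so an arc carries no information beyond its endpoints.
record Digraph : Set₁ where
  infix 4 _⟶_
  field
    Vertex   : Set
    order    : ℕ
    finite   : Vertex ↔ Fin order
    _⟶_      : Vertex → Vertex → Set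
    _⟶?_     : Decidable _⟶_
    loopless : Irreflexive _≡_ _⟶_

open Digraph public using (Vertex; order)

module _ (D : Digraph) where
  open Digraph D using (_⟶_)

  record Path (u v : Vertex D) : Set where
    field
      {arcs}   : ℕ
      vertex   : Vector (Vertex D) (suc arcs)
      distinct : Injective _≡_ _≡_ vertex
      step     : ∀ i → vertex (inject₁ i) ⟶ vertex (suc i)
      start    : vertex zero ≡ u
      end      : vertex (fromℕ arcs) ≡ v

  -- A cycle of length `suc last` visits `vertex 0 , … , vertex last` and then
  -- returns to `vertex 0`.  Length 1 is impossible because D is loopless.
  record Cycle : Set where
    field
      {last}   : ℕ
      vertex   : Vector (Vertex D) (suc last)
      distinct : Injective _≡_ _≡_ vertex
      step     : ∀ i → vertex (inject₁ i) ⟶ vertex (suc i)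
      close    : vertex (fromℕ last) ⟶ vertex zero

    length : ℕ
    length = suc last

    PassesThrough : Vertex D → Set
    PassesThrough v = ∃ λ i → vertex i ≡ v

  open Cycle using (length; PassesThrough)

  HasCycle : ℕ → Set
  HasCycle l = Σ Cycle λ C → length C ≡ l

  Hamiltonian : Set
  Hamiltonian = Σ Cycle λ C → ∀ v → PassesThrough C v

  Strong : Set
  Strong = ∀ u v → u ≢ v → Path u v × Path v u

  Pancyclic : Set
  Pancyclic = 3 ≤ order D × (∀ l → 3 ≤ l → l ≤ order D → HasCycle l)

  VertexPancyclic : Set
  VertexPancyclic =
    3 ≤ order D ×
    (∀ v l → 3 ≤ l → l ≤ order D →
      Σ Cycle λ C → length C ≡ l × PassesThrough C v)

ExactlyOne : Set → Set → Set
ExactlyOne A B = (A × ¬ B) ⊎ (¬ A × B)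

-- `D ∈ D₁ ⊕ D₂`.  Vertex-disjointness of D₁ and D₂ together with
-- V(D) = V(D₁) ∪ V(D₂) is the bijection `vertices`.
infix 4 _∈_⊕_
record _∈_⊕_ (D D₁ D₂ : Digraph) : Set where
  private
    module D  = Digraph D
    module D₁ = Digraph D₁
    module D₂ = Digraph D₂

  field
    vertices : (Vertex D₁ ⊎ Vertex D₂) ↔ Vertex D

  ι₁ : Vertex D₁ → Vertex D
  ι₁ = Inverse.to vertices ∘ inj₁

  ι₂ : Vertex D₂ → Vertex D
  ι₂ = Inverse.to vertices ∘ inj₂

  field
    induced₁ : ∀ u v → (u D₁.⟶ v) ⇔ (ι₁ u D.⟶ ι₁ v)
    induced₂ : ∀ u v → (u D₂.⟶ v) ⇔ (ι₂ u D.⟶ ι₂ v)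
    between  : ∀ u v → ExactlyOne (ι₁ u D.⟶ ι₂ v) (ι₂ v D.⟶ ι₁ u)

-- Let x₀ … xₙ₋₁ and y₀ … yₘ₋₁ be Hamiltonian cycles of D₁ and D₂, with indices
-- read modulo n and m, and let a(s,r) record whether xₛ → yᵣ (otherwise
-- yᵣ → xₛ).  D is in fact always pancyclic.
--
-- If a(s,r) holds and a(w+s,q+r) fails, then x_{w+s} … x_{n+s} followed by
-- yᵣ … y_{q+r} is a cycle, of length (n-w)+q+2.  So either this length occurs
-- or, a being periodic, a is invariant under the shift (w,q).
--
-- For 3 ≤ l < n+m there are two admissible shifts (w,q) and (w+1,q+1) for l.  If
-- both leave a invariant, then a(s+1,r+1) = a(s,r), and every row of a has periods
-- l-2 and n.  Strong connectivity makes row 0 non-constant, so a(0,j) fails and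
-- a(0,j+1) holds for some j, and the wanted cycle is x₀, y_{j+1} … y_{j+1+q},
-- x₁ … x_{p+1}, y_j for suitable p and q.
--
-- For l = n+m the only shift is (1,m-1), whose invariance means
-- a(s+1,r) = a(s,r+1).  Row 0 is again non-constant, hence switches from true to
-- false at some v and back at some t, and x₀, y_{t+1} … y_v, x₁ … xₙ₋₁,
-- y_{v+1} … y_t is a Hamiltonian cycle.
module Submission where

open import Defs
open import Data.Nat using (ℕ; _+_; _*_; _≤_; _<_; _≥_)
open import Data.Nat.Divisibility using (quotient)
open import Data.Nat.GCD using (gcd; gcd[m,n]∣n)
open import Data.Product using (∃; _×_)
open import Data.Sum using (_⊎_)
open import Relation.Binary.PropositionalEquality using (_≡_)

open import Algebra.Properties.CommutativeSemigroup using (x∙yz≈y∙xz; x∙yz≈z∙xy; x∙yz≈yx∙z;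
  xy∙z≈zy∙x; xy∙z≈yz∙x; xy∙z≈xz∙y)
open import Data.Bool using (Bool; true; false; not; _≟_)
open import Data.Bool.Properties using (¬-not; not-¬; ⇔→≡)
open import Data.Fin using (Fin; zero; suc; inject₁; fromℕ; toℕ)
open import Data.Fin.Permutation using (↔⇒≡)
open import Data.Fin.Properties using (toℕ-injective; toℕ-inject₁; toℕ-fromℕ; toℕ-fromℕ<; toℕ<n;
  +↔⊎)
open import Data.List using (List; []; _∷_; _++_; length; lookup; applyUpTo)
open import Data.List.Membership.Propositional.Properties using (∈-++⁻; ∈-lookup; ∈-applyUpTo⁻)
open import Data.List.Properties using (length-++; length-applyUpTo)
open import Data.List.Relation.Binary.Disjoint.Propositional using (Disjoint)
import Data.List.Relation.Unary.All as All
open import Data.List.Relation.Unary.AllPairs using (_∷_)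
open import Data.List.Relation.Unary.Unique.Propositional using (Unique)
import Data.List.Relation.Unary.Unique.Propositional.Properties as Unique
open import Data.Nat using (zero; suc; s≤s; s≤s⁻¹; z≤n; _%_; _/_; _∸_)
open import Data.Nat.DivMod using (_mod_; m%n<n; m≡m%n+[m/n]*n; [m+kn]%n≡m%n; m<n⇒m%n≡m; n%n≡0;
  /-monoˡ-≤; [m+n]%n≡m%n)
open import Data.Nat.Properties using (+-mono-≤; n≤1+n; ≤-reflexive; m∸n+n≡m;
  *-commutativeSemigroup; *-monoˡ-≤; *-suc; +-assoc; +-cancelʳ-≡; +-comm; +-commutativeSemigroup;
  +-identityʳ; +-monoʳ-≤; +-monoˡ-<; +-monoˡ-≤; +-suc; <⇒≢; <⇒≤; anyUpTo?; m+[n∸m]≡n; m+n≤o⇒m≤o;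
  m+n≤o⇒n≤o; m≤n+m; m≤n+o⇒m∸n≤o; m≤n⇒m<n∨m≡n; m≤n⇒m≤1+n; suc-injective; ≤-refl; ≤-total; ≤-trans;
  ≤⇒≯; module ≤-Reasoning)
open import Data.Product using (_,_; proj₁; proj₂)
open import Data.Sum using (inj₁; inj₂; [_,_]′)
open import Data.Sum.Function.Propositional using (_⊎-↔_)
open import Data.Sum.Properties using (inj₁-injective; inj₂-injective)
open import Function using (_∘_)
open import Function.Bundles using (Inverse; Equivalence; mk⇔; mk⤖)
open import Function.Definitions using (Injective)
open import Function.Properties.Bijection using (⤖⇒↔)
open import Function.Construct.Composition using (_↔-∘_)
open import Function.Construct.Symmetry using (↔-sym)
open import Relation.Binary.PropositionalEquality using (_≢_; refl; sym; trans; cong; cong₂; subst;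
  subst₂; module ≡-Reasoning)
open import Relation.Nullary using (¬_; yes; no; does; contradiction)
open import Relation.Nullary.Decidable using (_×-dec_; dec-true; dec-false)

-- Lists, splitting a number, and crossing between two sides.

Disjoint-++ʳ : ∀ {A : Set} {xs : List A} ys {zs} →
               Disjoint xs ys → Disjoint xs zs → Disjoint xs (ys ++ zs)
Disjoint-++ʳ ys xs#ys xs#zs (x∈xs , x∈ys++zs) =
  [ (λ x∈ys → xs#ys (x∈xs , x∈ys)) , (λ x∈zs → xs#zs (x∈xs , x∈zs)) ]′
    (∈-++⁻ ys x∈ys++zs)

Disjoint-sym : ∀ {A : Set} {xs ys : List A} → Disjoint xs ys → Disjoint ys xs
Disjoint-sym xs#ys (x∈ys , x∈xs) = xs#ys (x∈xs , x∈ys)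

lookup-injective : ∀ {A : Set} {xs : List A} → Unique xs → Injective _≡_ _≡_ (lookup xs)
lookup-injective (x∉xs ∷ xs!) {zero} {zero} eq = refl
lookup-injective (x∉xs ∷ xs!) {zero} {suc j} eq = contradiction eq (All.lookup x∉xs (∈-lookup j))
lookup-injective (x∉xs ∷ xs!) {suc i} {zero} eq = contradiction (sym eq) (All.lookup x∉xs (∈-lookup i))
lookup-injective (x∉xs ∷ xs!) {suc i} {suc j} eq = cong suc (lookup-injective xs! eq)

-- Serves to distribute a prescribed cycle length over two tours; the first summand is filled first.
≤-+-split : ∀ {k} a b → k ≤ a + b → ∃ λ p → ∃ λ q → p ≤ a × q ≤ b × k ≡ p + q
≤-+-split {k} a b k≤a+b with ≤-total k a
... | inj₁ k≤a = k , 0 , k≤a , z≤n , sym (+-identityʳ k)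
... | inj₂ a≤k = a , k ∸ a , ≤-refl , m≤n+o⇒m∸n≤o k a k≤a+b , sym (m+[n∸m]≡n a≤k)

-- Applied to a path from one side of the sum to the other, this yields an arc that crosses over.
exit-step : ∀ {A : Set} {P Q : A → Set} →
            (∀ x → P x ⊎ Q x) → (∀ {x} → P x → ¬ Q x) →
            ∀ k (f : Fin (suc k) → A) → P (f zero) → Q (f (fromℕ k)) →
            ∃ λ i → P (f (inject₁ i)) × Q (f (suc i))
exit-step cover disj zero f p q = contradiction q (disj p)
exit-step cover disj (suc k) f p q with cover (f (suc zero))
... | inj₂ q₁ = zero , p , q₁
... | inj₁ p₁ with i , pᵢ , qᵢ ← exit-step cover disj k (f ∘ suc) p₁ q = suc i , pᵢ , qᵢ

-- Boolean sequences and periodic Boolean matrices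

-- The search descends from `k` and stops at the largest `t` below it with value `b`. The bound on
-- `t` later keeps two pieces of a tour within one period.
switch : ∀ (h : ℕ → Bool) {b} i k → h i ≡ b → h (k + i) ≡ not b →
         ∃ λ t → t < k × h (t + i) ≡ b × h (suc t + i) ≡ not b
switch h i zero hi≡b hi≡¬b = contradiction hi≡¬b (not-¬ hi≡b)
switch h {b} i (suc k) hi≡b h≡¬b with h (k + i) ≟ b
... | yes h≡b = k , ≤-refl , h≡b , h≡¬b
... | no h≢b with t , t<k , eq , eq′ ← switch h i k hi≡b (¬-not h≢b)
  = t , m≤n⇒m≤1+n t<k , eq , eq′

module PeriodicMatrix
  (a : ℕ → ℕ → Bool) (n₁ m₁ : ℕ)
  (row-periodic : ∀ s r → a s (suc m₁ + r) ≡ a s r)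
  (col-periodic : ∀ s r → a (suc n₁ + s) r ≡ a s r)
  where

  private
    n m : ℕ
    n = suc n₁
    m = suc m₁

  col-wrap : ∀ r → a n r ≡ a 0 r
  col-wrap r = trans (cong (λ i → a i r) (sym (+-identityʳ n))) (col-periodic 0 r)

  row-periodic-* : ∀ c s r → a s (c * m + r) ≡ a s r
  row-periodic-* zero s r = refl
  row-periodic-* (suc c) s r =
    trans (cong (a s) (+-assoc m (c * m) r)) (trans (row-periodic s _) (row-periodic-* c s r))

  col-periodic-* : ∀ c s r → a (c * n + s) r ≡ a s r
  col-periodic-* zero s r = refl
  col-periodic-* (suc c) s r =
    trans (cong (λ i → a i r) (+-assoc n (c * n) s)) (trans (col-periodic _ r) (col-periodic-* c s r))

  periodic-* : ∀ c d s r → a (c * n + s) (d * m + r) ≡ a s r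
  periodic-* c d s r = trans (col-periodic-* c s _) (row-periodic-* d s r)

  -- Makes the search for a drop finite: the starting entry may be taken within one period in each
  -- direction.
  reduce : ∀ w q s r → a (w + s) (q + r) ≡ a (w + s % n) (q + r % m)
  reduce w q s r =
    trans (cong₂ a (shift w (s % n) _ s (m≡m%n+[m/n]*n s n)) (shift q (r % m) _ r (m≡m%n+[m/n]*n r m)))
          (periodic-* (s / n) (r / m) _ _)
    where
    shift : ∀ x y z t → t ≡ y + z → x + t ≡ z + (x + y)
    shift x y z _ refl = x∙yz≈z∙xy +-commutativeSemigroup x y z

  row-switch : ∀ s {b} i j → a s i ≡ b → a s j ≡ not b →
               ∃ λ t → a s t ≡ b × a s (suc t) ≡ not b
  row-switch s i j hi hj =
    -- Moving `j` forward by `i` whole periods puts it at or beyond `i`, whichever of the two is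
    -- larger; `j + i * m₁` is the remaining distance.
    let t , _ , eq , eq′ = switch (a s) i (j + i * m₁) hi
          (trans (cong (a s) idx) (trans (row-periodic-* i s j) hj))
    in t + i , eq , eq′
    where
    idx : j + i * m₁ + i ≡ i * m + j
    idx = trans (xy∙z≈zy∙x +-commutativeSemigroup j (i * m₁) i) (cong (_+ j) (sym (*-suc i m₁)))

  Invariant : ℕ → ℕ → Set
  Invariant w q = ∀ s r → a (w + s) (q + r) ≡ a s r

  -- Shifts have finite order on the torus ℤ/n × ℤ/m, so an implication along a
  -- shift is already an equivalence.
  monotone⇒invariant : ∀ w q → (∀ s r → a s r ≡ true → a (w + s) (q + r) ≡ true) →
                       Invariant w q
  monotone⇒invariant w q mono s r = ⇔→≡ (mk⇔ back (mono s r))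
    where
    iterate : ∀ c s r → a s r ≡ true → a (c * w + s) (c * q + r) ≡ true
    iterate zero s r e = e
    iterate (suc c) s r e =
      trans (cong₂ a (+-assoc w (c * w) s) (+-assoc q (c * q) r)) (mono _ _ (iterate c s r e))

    -- The shift applied `n * m` times is trivial, so `n * m - 1` applications undo the first one.
    nm-1 = m₁ + n₁ * m

    back : a (w + s) (q + r) ≡ true → a s r ≡ true
    back e = begin
      a s r                                       ≡⟨ periodic-* (m * w) (n * q) s r ⟨
      a (m * w * n + s) (n * q * m + r)           ≡⟨ cong₂ (λ i j → a (i + s) (j + r))
                                                       (xy∙z≈yz∙x *-commutativeSemigroup n m w)
                                                       (xy∙z≈xz∙y *-commutativeSemigroup n m q) ⟨
      a (n * m * w + s) (n * m * q + r)           ≡⟨ cong₂ a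
                                                       (x∙yz≈yx∙z +-commutativeSemigroup (nm-1 * w) w s)
                                                       (x∙yz≈yx∙z +-commutativeSemigroup (nm-1 * q) q r) ⟨
      a (nm-1 * w + (w + s)) (nm-1 * q + (q + r)) ≡⟨ iterate nm-1 _ _ e ⟩
      true                                        ∎
      where open ≡-Reasoning

  -- If none of the `n * m` entries of one period drops from true to false, the shift preserves
  -- truth, and then it preserves all entries.
  drop-or-invariant : ∀ w q →
    (∃ λ s → ∃ λ r → a s r ≡ true × a (w + s) (q + r) ≡ false) ⊎ Invariant w q
  drop-or-invariant w q
    with anyUpTo? (λ s → anyUpTo? (λ r → (a s r ≟ true) ×-dec (a (w + s) (q + r) ≟ false)) m) n
  ... | yes (s , _ , r , _ , drop) = inj₁ (s , r , drop)
  ... | no ¬drop = inj₂ (monotone⇒invariant w q λ s r e → trans (reduce w q s r)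
          (¬-not λ f → ¬drop (s % n , m%n<n s n , r % m , m%n<n r m ,
                               trans (sym (reduce 0 0 s r)) e , f)))

  module Diagonal (diagonal : ∀ s r → a (suc s) (suc r) ≡ a s r) where

    diagonal-+ : ∀ t s r → a (t + s) (t + r) ≡ a s r
    diagonal-+ zero s r = refl
    diagonal-+ (suc t) s r = trans (diagonal _ _) (diagonal-+ t s r)

    -- Of `n` diagonal steps, the row part is absorbed by the column period; only the column part
    -- remains.
    row-periodicₙ : ∀ s r → a s (n + r) ≡ a s r
    row-periodicₙ s r = trans (sym (col-periodic s (n + r))) (diagonal-+ n s r)

    -- Going `s * n₁` steps further down the diagonal leads to row `s * n`, which equals row 0.
    -- Hence row 0 takes every value that the matrix takes.
    top-row : ∀ s r → ∃ λ t → a 0 t ≡ a s r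
    top-row s r = s * n₁ + r ,
      trans (sym (col-periodic-* s 0 _))
        (trans (cong (λ i → a i (s * n₁ + r))
                 (trans (+-identityʳ (s * n)) (trans (*-suc s n₁) (+-comm s (s * n₁)))))
               (diagonal-+ (s * n₁) s r))

  module Antidiagonal (antidiagonal : ∀ s r → a (suc s) r ≡ a s (suc r)) where

    top-row : ∀ s r → a s r ≡ a 0 (s + r)
    top-row zero r = refl
    top-row (suc s) r =
      trans (antidiagonal s r) (trans (top-row s (suc r)) (cong (a 0) (+-suc s r)))

    row-periodicₙ : ∀ r → a 0 (n + r) ≡ a 0 r
    row-periodicₙ r = trans (sym (top-row n r)) (col-wrap r)

-- Walks, and cycles run through periodically

module _ (D : Digraph) where
  open Digraph D using (_⟶_)

  -- Walk u xs v visits u ∷ xs.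
  data Walk : Vertex D → List (Vertex D) → Vertex D → Set where
    []  : ∀ {u} → Walk u [] u
    _∷_ : ∀ {u w xs v} → u ⟶ w → Walk w xs v → Walk u (w ∷ xs) v

  -- A cycle unrolled along ℕ, so that a stretch may start anywhere without modular indices.
  -- Distinctness becomes injectivity on each window of `n` consecutive indices.
  record Tour (n : ℕ) : Set where
    field
      at        : ℕ → Vertex D
      step      : ∀ i → at i ⟶ at (suc i)
      periodic  : ∀ i → at (n + i) ≡ at i
      injective : ∀ {i j} → i ≤ j → j < n + i → at i ≡ at j → i ≡ j

    -- `k` counts arcs, so `k + 1` vertices are listed.
    segment : ℕ → ℕ → List (Vertex D)
    segment i k = applyUpTo (λ t → at (t + i)) (suc k)

    length-segment : ∀ i k → length (segment i k) ≡ suc k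
    length-segment i k = length-applyUpTo (λ t → at (t + i)) (suc k)

module _ {D : Digraph} where
  open Digraph D using (_⟶_)

  walk-++ : ∀ {u v w z xs ys} → Walk D u xs v → v ⟶ w → Walk D w ys z →
            Walk D u (xs ++ w ∷ ys) z
  walk-++ [] v⟶w q = v⟶w ∷ q
  walk-++ (e ∷ p) v⟶w q = e ∷ walk-++ p v⟶w q

  walk-step : ∀ {u xs v} → Walk D u xs v → ∀ i →
              lookup (u ∷ xs) (inject₁ i) ⟶ lookup (u ∷ xs) (suc i)
  walk-step (e ∷ p) zero = e
  walk-step (e ∷ p) (suc i) = walk-step p i

  walk-end : ∀ {u xs v} → Walk D u xs v → lookup (u ∷ xs) (fromℕ (length xs)) ≡ v
  walk-end [] = refl
  walk-end (e ∷ p) = walk-end p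

  walk-applyUpTo : ∀ (f : ℕ → Vertex D) → (∀ i → f i ⟶ f (suc i)) →
                   ∀ k → Walk D (f 0) (applyUpTo (f ∘ suc) k) (f k)
  walk-applyUpTo f f-step zero = []
  walk-applyUpTo f f-step (suc k) = f-step 0 ∷ walk-applyUpTo (f ∘ suc) (f-step ∘ suc) k

  closedWalk : ∀ {u xs v} → Walk D u xs v → v ⟶ u → Unique (u ∷ xs) →
               HasCycle D (length (u ∷ xs))
  closedWalk {u} {xs} p v⟶u u∷xs! = record
    { vertex   = lookup (u ∷ xs)
    ; distinct = lookup-injective u∷xs!
    ; step     = walk-step p
    ; close    = subst (_⟶ u) (sym (walk-end p)) v⟶u
    } , refl

  module _ {n} (X : Tour D n) where
    open Tour X

    segment-walk : ∀ i k → Walk D (at i) (applyUpTo (λ t → at (suc t + i)) k) (at (k + i))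
    segment-walk i = walk-applyUpTo (λ t → at (t + i)) (λ t → step (t + i))

    segment-unique : ∀ i k → k < n → Unique (segment i k)
    segment-unique i k k<n = Unique.applyUpTo⁺₁ _ _ λ {s} {t} s<t t≤k eq →
      <⇒≢ s<t (+-cancelʳ-≡ i s t (injective (+-monoˡ-≤ i (<⇒≤ s<t))
        (≤-trans (+-monoˡ-< i (≤-trans t≤k k<n)) (+-monoʳ-≤ n (m≤n+m i s))) eq))

    -- Both segments lie in the window of `n` indices starting at `i`, without overlap.
    segment-disjoint : ∀ i k j l → k + i < j → l + j < n + i →
                       Disjoint (segment i k) (segment j l)
    segment-disjoint i k j l k+i<j l+j<n+i (v∈ , v∈′)
      with s , s≤k , refl ← ∈-applyUpTo⁻ (λ t → at (t + i)) v∈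
      with t , t≤l , eq ← ∈-applyUpTo⁻ (λ t → at (t + j)) v∈′
      = <⇒≢ s+i<t+j (injective (<⇒≤ s+i<t+j) t+j<n+[s+i] eq)
      where
      s+i<t+j : s + i < t + j
      s+i<t+j = ≤-trans (s≤s (+-monoˡ-≤ i (s≤s⁻¹ s≤k))) (≤-trans k+i<j (m≤n+m j t))
      t+j<n+[s+i] : t + j < n + (s + i)
      t+j<n+[s+i] = ≤-trans (s≤s (+-monoˡ-≤ j (s≤s⁻¹ t≤l)))
                      (≤-trans l+j<n+i (+-monoʳ-≤ n (m≤n+m i s)))

module _ {D : Digraph} (C : Cycle D) where
  open Digraph D using (_⟶_)
  open Cycle C

  private
    n : ℕ
    n = suc last

  toℕ-mod : ∀ i → toℕ (i mod n) ≡ i % n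
  toℕ-mod i = toℕ-fromℕ< (m%n<n i n)

  vertex-step : ∀ (i j : Fin n) → toℕ j ≡ suc (toℕ i) → vertex i ⟶ vertex j
  vertex-step i (suc j) eq =
    subst (λ k → vertex k ⟶ vertex (suc j))
      (toℕ-injective (trans (toℕ-inject₁ j) (suc-injective eq))) (Cycle.step C j)

  vertex-close : ∀ (i j : Fin n) → toℕ i ≡ last → toℕ j ≡ 0 → vertex i ⟶ vertex j
  vertex-close i zero eq _ =
    subst (λ k → vertex k ⟶ vertex zero)
      (toℕ-injective (trans (toℕ-fromℕ last) (sym eq))) close

  suc-% : ∀ i → suc i % n ≡ suc (i % n) % n
  suc-% i = trans (cong (λ k → suc k % n) (m≡m%n+[m/n]*n i n)) ([m+kn]%n≡m%n (suc (i % n)) (i / n) n)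

  -- Either the remainder grows by one, along an inner arc, or it wraps from `last` to 0, along the
  -- closing arc.
  mod-step : ∀ i → vertex (i mod n) ⟶ vertex (suc i mod n)
  mod-step i with m≤n⇒m<n∨m≡n (s≤s⁻¹ (m%n<n i n))
  ... | inj₁ i%n<last = vertex-step _ _
    (trans (toℕ-mod (suc i)) (trans (suc-% i) (trans (m<n⇒m%n≡m (s≤s i%n<last)) (cong suc (sym (toℕ-mod i))))))
  ... | inj₂ i%n≡last = vertex-close _ _ (trans (toℕ-mod i) i%n≡last)
    (trans (toℕ-mod (suc i)) (trans (suc-% i) (trans (cong (λ k → suc k % n) i%n≡last) (n%n≡0 n))))

  -- With equal remainders, a larger quotient would put `j` at least `n` beyond `i`.
  %-injective-window : ∀ {i j} → i ≤ j → j < n + i → i % n ≡ j % n → i ≡ j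
  %-injective-window {i} {j} i≤j j<n+i eq with m≤n⇒m<n∨m≡n (/-monoˡ-≤ n i≤j)
  ... | inj₂ i/n≡j/n = trans (m≡m%n+[m/n]*n i n)
          (trans (cong₂ (λ x y → x + y * n) eq i/n≡j/n) (sym (m≡m%n+[m/n]*n j n)))
  ... | inj₁ i/n<j/n = contradiction j<n+i (≤⇒≯ (begin
    n + i                         ≡⟨ cong (n +_) (m≡m%n+[m/n]*n i n) ⟩
    n + (i % n + i / n * n)       ≡⟨ x∙yz≈y∙xz +-commutativeSemigroup n (i % n) (i / n * n) ⟩
    i % n + (suc (i / n)) * n     ≤⟨ +-monoʳ-≤ (i % n) (*-monoˡ-≤ n i/n<j/n) ⟩
    i % n + j / n * n             ≡⟨ cong (_+ j / n * n) eq ⟩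
    j % n + j / n * n             ≡⟨ m≡m%n+[m/n]*n j n ⟨
    j                             ∎))
    where
    open ≤-Reasoning

  cycle⇒tour : Tour D n
  cycle⇒tour = record
    { at        = λ i → vertex (i mod n)
    ; step      = mod-step
    ; periodic  = λ i → cong vertex (toℕ-injective
        (trans (toℕ-mod (n + i)) (trans (trans (cong (_% n) (+-comm n i)) ([m+n]%n≡m%n i n)) (sym (toℕ-mod i)))))
    ; injective = λ {i} {j} i≤j j<n+i eq → %-injective-window i≤j j<n+i
        (trans (sym (toℕ-mod i)) (trans (cong toℕ (distinct eq)) (toℕ-mod j)))
    }

  tour-covers : ∀ v → PassesThrough v → ∃ λ i → Tour.at cycle⇒tour i ≡ v
  tour-covers v (i , vᵢ≡v) = toℕ i ,
    trans (cong vertex (toℕ-injective (trans (toℕ-mod (toℕ i)) (m<n⇒m%n≡m (toℕ<n i))))) vᵢ≡v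

  -- A one-vertex cycle would close up in a loop. Hence tour lengths can be written `2 + k`.
  last≢0 : last ≢ 0
  last≢0 eq = Digraph.loopless D refl (vertex-close zero zero (sym eq) refl)

  spanning⇒length≡order : (∀ v → PassesThrough v) → n ≡ order D
  spanning⇒length≡order cover = ↔⇒≡ (Digraph.finite D ↔-∘
    ⤖⇒↔ (mk⤖ {to = vertex} (distinct , λ v → proj₁ (cover v) , λ { refl → proj₂ (cover v) })))

mapTour : ∀ {D D′ : Digraph} {n} (f : Vertex D → Vertex D′) → Injective _≡_ _≡_ f →
          (∀ {u v} → Digraph._⟶_ D u v → Digraph._⟶_ D′ (f u) (f v)) →
          Tour D n → Tour D′ n
mapTour f f-injective f-hom X = record
  { at        = f ∘ at
  ; step      = f-hom ∘ step
  ; periodic  = cong f ∘ periodic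
  ; injective = λ i≤j j<n+i eq → injective i≤j j<n+i (f-injective eq)
  }
  where open Tour X

-- The cycles of D that use two or four arcs between D₁ and D₂

module TwoTours
  {D : Digraph} (n₂ m₂ : ℕ) (X : Tour D (2 + n₂)) (Y : Tour D (2 + m₂))
  (disjoint : ∀ s r → Tour.at X s ≢ Tour.at Y r)
  where

  open Digraph D using (_⟶_)
  private
    module X = Tour X
    module Y = Tour Y
    n m : ℕ
    n = 2 + n₂
    m = 2 + m₂

  segments-disjoint : ∀ i k j l → Disjoint (X.segment i k) (Y.segment j l)
  segments-disjoint i k j l (v∈ , v∈′)
    with s , _ , refl ← ∈-applyUpTo⁻ (λ t → X.at (t + i)) v∈
    with t , _ , eq ← ∈-applyUpTo⁻ (λ t → Y.at (t + j)) v∈′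
    = disjoint _ _ eq

  two-arc-cycle : ∀ {s r} p q → p < n → q < m →
    X.at (p + s) ⟶ Y.at r → Y.at (q + r) ⟶ X.at s → HasCycle D (2 + (p + q))
  two-arc-cycle {s} {r} p q p<n q<m x⟶y y⟶x = subst (HasCycle D) len
    (closedWalk (walk-++ (segment-walk X s p) x⟶y (segment-walk Y r q)) y⟶x
      (Unique.++⁺ (segment-unique X s p p<n) (segment-unique Y r q q<m)
        (segments-disjoint s p r q)))
    where
    len : length (X.segment s p ++ Y.segment r q) ≡ 2 + (p + q)
    len = trans (length-++ (X.segment s p))
      (trans (cong₂ _+_ (X.length-segment s p)
                        (Y.length-segment r q)) (cong suc (+-suc p q)))

  -- xₛ → y_{q₂+r+1} … y_{q₁+q₂+r+1} → x_{s+1} … x_{p+s+1} → yᵣ … y_{q₂+r} → xₛ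
  four-arc-cycle : ∀ {s r} p q₁ q₂ → p ≤ n₂ → q₁ + q₂ ≤ m₂ →
    X.at s ⟶ Y.at (suc q₂ + r) → Y.at (q₁ + (suc q₂ + r)) ⟶ X.at (suc s) →
    X.at (p + suc s) ⟶ Y.at r → Y.at (q₂ + r) ⟶ X.at s →
    HasCycle D (4 + (q₁ + (p + q₂)))
  four-arc-cycle {s} {r} p q₁ q₂ p≤n₂ q≤m₂ a₁ a₂ a₃ a₄ = subst (HasCycle D) len
    (closedWalk
      (walk-++ (segment-walk X s 0) a₁
        (walk-++ (segment-walk Y (suc q₂ + r) q₁) a₂
          (walk-++ (segment-walk X (suc s) p) a₃ (segment-walk Y r q₂))))
      a₄
      (Unique.++⁺ (segment-unique X s 0 (s≤s z≤n))
        (Unique.++⁺ (segment-unique Y _ q₁ q₁<m)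
          (Unique.++⁺ (segment-unique X _ p (s≤s (m≤n⇒m≤1+n p≤n₂))) (segment-unique Y r q₂ q₂<m)
            (segments-disjoint _ p r q₂))
          (Disjoint-++ʳ P₂ (Disjoint-sym (segments-disjoint _ p _ q₁))
            (Disjoint-sym (segment-disjoint Y r q₂ _ q₁ ≤-refl Q₁-fits))))
        (Disjoint-++ʳ Q₁ (segments-disjoint s 0 _ q₁)
          (Disjoint-++ʳ P₂ (segment-disjoint X s 0 (suc s) p ≤-refl P₂-fits)
            (segments-disjoint s 0 r q₂)))))
    where
    P₁ = X.segment s 0
    P₂ = X.segment (suc s) p
    Q₁ = Y.segment (suc q₂ + r) q₁
    Q₂ = Y.segment r q₂

    q₁<m : q₁ < m
    q₁<m = s≤s (m≤n⇒m≤1+n (m+n≤o⇒m≤o q₁ q≤m₂))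
    q₂<m : q₂ < m
    q₂<m = s≤s (m≤n⇒m≤1+n (m+n≤o⇒n≤o q₁ q≤m₂))

    -- The bounds `p ≤ n₂` and `q₁ + q₂ ≤ m₂` say that the two pieces on each tour have at most `n`,
    -- respectively `m`, vertices together.
    P₂-fits : p + suc s < n + s
    P₂-fits = subst (_< n + s) (sym (+-suc p s)) (s≤s (s≤s (+-monoˡ-≤ s p≤n₂)))

    Q₁-fits : q₁ + (suc q₂ + r) < m + r
    Q₁-fits = subst (_≤ m + r)
      (cong suc (sym (trans (+-suc q₁ (q₂ + r)) (cong suc (sym (+-assoc q₁ q₂ r))))))
      (s≤s (s≤s (+-monoˡ-≤ r q≤m₂)))

    len : length (P₁ ++ Q₁ ++ P₂ ++ Q₂) ≡ 4 + (q₁ + (p + q₂))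
    len = trans (cong suc (trans (length-++ Q₁) (cong₂ _+_ (Y.length-segment (suc q₂ + r) q₁)
            (trans (length-++ P₂) (cong₂ _+_ (X.length-segment (suc s) p) (Y.length-segment r q₂))))))
          (cong (2 +_) (trans (+-suc q₁ (p + suc q₂))
            (cong suc (trans (cong (q₁ +_) (+-suc p q₂)) (+-suc q₁ (p + q₂))))))

-- Cycles of every length in a strong sum of two tours.

module StrongSum
  {D : Digraph} (n₂ m₂ : ℕ) (X : Tour D (2 + n₂)) (Y : Tour D (2 + m₂))
  (disjoint : ∀ s r → Tour.at X s ≢ Tour.at Y r)
  (cover : ∀ v → (∃ λ s → Tour.at X s ≡ v) ⊎ (∃ λ r → Tour.at Y r ≡ v))
  (between : ∀ s r → ExactlyOne (Digraph._⟶_ D (Tour.at X s) (Tour.at Y r))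
                                (Digraph._⟶_ D (Tour.at Y r) (Tour.at X s)))
  (strong : Strong D)
  where

  open Digraph D using (_⟶_)
  private
    module X = Tour X
    module Y = Tour Y
    n m : ℕ
    n = 2 + n₂
    m = 2 + m₂

  open TwoTours {D} n₂ m₂ X Y disjoint

  arc? : Vertex D → Vertex D → Bool
  arc? u v = does (Digraph._⟶?_ D u v)

  a : ℕ → ℕ → Bool
  a s r = arc? (X.at s) (Y.at r)

  row-periodic : ∀ s r → a s (m + r) ≡ a s r
  row-periodic s r = cong (arc? (X.at s)) (Y.periodic r)

  col-periodic : ∀ s r → a (n + s) r ≡ a s r
  col-periodic s r = cong (λ u → arc? u (Y.at r)) (X.periodic s)

  open PeriodicMatrix a (suc n₂) (suc m₂) row-periodic col-periodic

  true⇒x⟶y : ∀ {s r} → a s r ≡ true → X.at s ⟶ Y.at r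
  true⇒x⟶y {s} {r} e with yes x⟶y ← Digraph._⟶?_ D (X.at s) (Y.at r) = x⟶y

  false⇒y⟶x : ∀ {s r} → a s r ≡ false → Y.at r ⟶ X.at s
  false⇒y⟶x {s} {r} e with no ¬x⟶y ← Digraph._⟶?_ D (X.at s) (Y.at r) | between s r
  ... | inj₁ (x⟶y , _) = contradiction x⟶y ¬x⟶y
  ... | inj₂ (_ , y⟶x) = y⟶x

  x⇝y : Path D (X.at 0) (Y.at 0)
  x⇝y = proj₁ (strong _ _ (disjoint 0 0))

  y⇝x : Path D (Y.at 0) (X.at 0)
  y⇝x = proj₂ (strong _ _ (disjoint 0 0))

  -- Strong connectivity enters here and in `some-false`: paths in both directions must cross
  -- between the tours.
  some-true : ∃ λ s → ∃ λ r → a s r ≡ true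
  some-true
    with i , (s , xₛ≡u) , (r , yᵣ≡v) ←
      exit-step cover (λ { (s , refl) (r , eq) → disjoint s r (sym eq) })
        (Path.arcs x⇝y) (Path.vertex x⇝y)
        (0 , sym (Path.start x⇝y)) (0 , sym (Path.end x⇝y))
    = s , r , dec-true (Digraph._⟶?_ D _ _) (subst₂ _⟶_ (sym xₛ≡u) (sym yᵣ≡v) (Path.step x⇝y i))

  some-false : ∃ λ s → ∃ λ r → a s r ≡ false
  some-false
    with i , (r , yᵣ≡u) , (s , xₛ≡v) ←
      exit-step ([ inj₂ , inj₁ ]′ ∘ cover) (λ { (r , refl) (s , eq) → disjoint s r eq })
        (Path.arcs y⇝x) (Path.vertex y⇝x)
        (0 , sym (Path.start y⇝x)) (0 , sym (Path.end y⇝x))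
    with between s r
  ... | inj₁ (_ , ¬y⟶x) = contradiction (subst₂ _⟶_ (sym yᵣ≡u) (sym xₛ≡v) (Path.step y⇝x i)) ¬y⟶x
  ... | inj₂ (¬x⟶y , _) = s , r , dec-false (Digraph._⟶?_ D _ _) ¬x⟶y

  -- The X-part starts at `X.at (w + s)`, where the entry is false, and after `p` arcs reaches index
  -- `n + s`, where the entry is that of `s`, hence true.
  drop⇒cycle : ∀ w p q → w + p ≡ n → p < n → q < m →
               (∃ λ s → ∃ λ r → a s r ≡ true × a (w + s) (q + r) ≡ false) →
               HasCycle D (2 + (p + q))
  drop⇒cycle w p q w+p≡n p<n q<m (s , r , e , e′) =
    two-arc-cycle p q p<n q<m
      (true⇒x⟶y (trans (cong (λ i → a i r)
                         (trans (x∙yz≈yx∙z +-commutativeSemigroup p w s) (cong (_+ s) w+p≡n)))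
                       (trans (col-periodic s r) e)))
      (false⇒y⟶x e′)

  hamiltonian-cycle : HasCycle D (n + m)
  hamiltonian-cycle with drop-or-invariant 1 (suc m₂)
  ... | inj₁ drop = subst (HasCycle D)
          (sym (cong (2 +_) (+-suc n₂ (suc m₂))))
          (drop⇒cycle 1 (suc n₂) (suc m₂) refl ≤-refl ≤-refl drop)
  ... | inj₂ invariant = subst (HasCycle D) len
          -- Here `r = v + 1` and `t` is counted from `v + 1`. The pieces of Y have `t + 1` and
          -- `m - 1 - t` vertices, so all of Y is used.
          (four-arc-cycle n₂ (m₂ ∸ t) t ≤-refl (≤-reflexive m₂∸t+t≡m₂)
            (true⇒x⟶y h[t+1])
            (false⇒y⟶x (trans (top-row 1 _) (trans (cong (a 0) end) (trans (row-periodic 0 (suc v)) h[v+1]))))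
            (true⇒x⟶y (trans (top-row (n₂ + 1) (suc v))
              (trans (cong (a 0) (turn n₂ v)) (trans (row-periodicₙ v) h[v]))))
            (false⇒y⟶x h[t]))
    where
    antidiagonal : ∀ s r → a (suc s) r ≡ a s (suc r)
    -- Modulo `m`, adding `m - 1` to the column index subtracts one.
    antidiagonal s r = trans (sym (row-periodic (suc s) r))
      (trans (cong (a (suc s)) (sym (cong suc (+-suc m₂ r)))) (invariant s (suc r)))

    open Antidiagonal antidiagonal

    fall : ∃ λ v → a 0 v ≡ true × a 0 (suc v) ≡ false
    fall = let s , r , e = some-true; s′ , r′ , e′ = some-false in
      row-switch 0 _ _ (trans (sym (top-row s r)) e) (trans (sym (top-row s′ r′)) e′)

    v = proj₁ fall
    h[v] = proj₁ (proj₂ fall)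
    h[v+1] = proj₂ (proj₂ fall)

    rise : ∃ λ t → t < suc m₂ × a 0 (t + suc v) ≡ false × a 0 (suc t + suc v) ≡ true
    -- The search over `m - 1` places from `v + 1` ends at `m + v`, where row 0 is true by
    -- periodicity.
    rise = switch (a 0) (suc v) (suc m₂) h[v+1]
      (trans (cong (a 0) (cong suc (+-suc m₂ v))) (trans (row-periodic 0 v) h[v]))

    t = proj₁ rise
    h[t] = proj₁ (proj₂ (proj₂ rise))
    h[t+1] = proj₂ (proj₂ (proj₂ rise))

    m₂∸t+t≡m₂ : m₂ ∸ t + t ≡ m₂
    m₂∸t+t≡m₂ = m∸n+n≡m (s≤s⁻¹ (proj₁ (proj₂ rise)))

    end : suc (m₂ ∸ t + (suc t + suc v)) ≡ m + suc v
    end = cong suc (trans (+-suc (m₂ ∸ t) (t + suc v))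
      (cong suc (trans (sym (+-assoc (m₂ ∸ t) t (suc v))) (cong (_+ suc v) m₂∸t+t≡m₂))))

    turn : ∀ x v → x + 1 + suc v ≡ suc (suc x) + v
    turn x v = trans (cong (_+ suc v) (+-comm x 1)) (+-suc (suc x) v)

    len : 4 + (m₂ ∸ t + (n₂ + t)) ≡ n + m
    len = cong (2 +_) (trans (cong (2 +_) (x∙yz≈y∙xz +-commutativeSemigroup (m₂ ∸ t) n₂ t))
      (trans (cong (λ x → 2 + (n₂ + x)) m₂∸t+t≡m₂)
        (trans (cong suc (sym (+-suc n₂ m₂))) (sym (+-suc n₂ (suc m₂))))))

  -- The two shifts correspond to segments with `p + 1` and `q` arcs, or with `p` and `q + 1` arcs;
  -- the total length is the same.
  short-cycle : ∀ p q → p ≤ n₂ → q ≤ m₂ → HasCycle D (3 + (p + q))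
  short-cycle p q p≤n₂ q≤m₂ with drop-or-invariant w q | drop-or-invariant (suc w) (suc q)
    where w = suc (n₂ ∸ p)
  ... | inj₁ drop | _ = drop⇒cycle (suc (n₂ ∸ p)) (suc p) q
          (cong suc (trans (+-suc (n₂ ∸ p) p) (cong suc (m∸n+n≡m p≤n₂))))
          (s≤s (s≤s p≤n₂)) (s≤s (m≤n⇒m≤1+n q≤m₂)) drop
  ... | inj₂ _ | inj₁ drop = subst (HasCycle D) (cong (2 +_) (+-suc p q))
          (drop⇒cycle (2 + (n₂ ∸ p)) p (suc q) (cong (2 +_) (m∸n+n≡m p≤n₂))
            (s≤s (m≤n⇒m≤1+n p≤n₂)) (s≤s (s≤s q≤m₂)) drop)
  ... | inj₂ inv | inj₂ inv′ = four-arcs (p + q) refl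
    where
    w = suc (n₂ ∸ p)
    k = suc (p + q)

    diagonal : ∀ s r → a (suc s) (suc r) ≡ a s r
    -- The two invariant shifts differ by (1,1).
    diagonal s r = trans (sym (inv (suc s) (suc r)))
      (trans (cong₂ a (+-suc w s) (+-suc q r)) (inv′ s r))

    open Diagonal diagonal

    -- Since `w + k = n + q`, sliding by `w` along the diagonal turns the column shift `k` into the
    -- invariant shift `(w,q)`.
    row-periodicₖ : ∀ s r → a s (k + r) ≡ a s r
    row-periodicₖ s r = begin
      a s (k + r)             ≡⟨ diagonal-+ w s (k + r) ⟨
      a (w + s) (w + (k + r)) ≡⟨ cong (a (w + s)) w+k+r≡n+q+r ⟩
      a (w + s) (n + (q + r)) ≡⟨ row-periodicₙ (w + s) (q + r) ⟩
      a (w + s) (q + r)       ≡⟨ inv s r ⟩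
      a s r                   ∎
      where
      open ≡-Reasoning
      w+k+r≡n+q+r : w + (k + r) ≡ n + (q + r)
      w+k+r≡n+q+r = cong suc (trans (+-suc (n₂ ∸ p) (p + q + r)) (cong suc
        (trans (cong (n₂ ∸ p +_) (+-assoc p q r))
          (trans (sym (+-assoc (n₂ ∸ p) p (q + r))) (cong (_+ (q + r)) (m∸n+n≡m p≤n₂))))))

    rise : ∃ λ j → a 0 j ≡ false × a 0 (suc j) ≡ true
    rise =
      let s , r , e = some-false; i , eᵢ = top-row s r
          s′ , r′ , e′ = some-true; i′ , eᵢ′ = top-row s′ r′
      in row-switch 0 i i′ (trans eᵢ e) (trans eᵢ′ e′)

    j = proj₁ rise
    h[j] = proj₁ (proj₂ rise)
    h[j+1] = proj₂ (proj₂ rise)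

    four-arcs : ∀ l → p + q ≡ l → HasCycle D (3 + l)
    -- Here `k = 1`, so row 0 would be constant.
    four-arcs zero eq = contradiction
      (trans (sym h[j+1]) (trans (trans (cong (λ l → a 0 (suc l + j)) (sym eq)) (row-periodicₖ 0 j)) h[j]))
      λ ()
    -- The `l` arcs of the two long pieces go to X as far as `n₂` allows, and the excess to Y.
    -- Throughout, `k = l + 2`.
    four-arcs (suc l) eq with ≤-total l n₂
    ... | inj₁ l≤n₂ = subst (HasCycle D) (cong (4 +_) (+-identityʳ l))
            (four-arc-cycle l 0 0 l≤n₂ z≤n
              (true⇒x⟶y h[j+1])
              (false⇒y⟶x (trans (diagonal 0 j) h[j]))
              (true⇒x⟶y (begin
                a (l + 1) j               ≡⟨ diagonal (l + 1) j ⟨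
                a (suc (l + 1)) (suc j)   ≡⟨ row-periodicₖ (suc (l + 1)) (suc j) ⟨
                a (suc (l + 1)) (k + suc j) ≡⟨ cong₂ (λ x y → a x (suc y + suc j))
                                                 (trans (cong suc (+-comm l 1)) (sym (+-identityʳ (2 + l)))) eq ⟩
                a (2 + l + 0) (2 + l + suc j) ≡⟨ diagonal-+ (2 + l) 0 (suc j) ⟩
                a 0 (suc j)               ≡⟨ h[j+1] ⟩
                true                      ∎))
              (false⇒y⟶x h[j]))
      where open ≡-Reasoning
    ... | inj₂ n₂≤l = subst (HasCycle D) (cong (4 +_) (trans (cong (e +_) (+-identityʳ n₂)) (m∸n+n≡m n₂≤l)))
            (four-arc-cycle n₂ (l ∸ n₂) 0 ≤-refl e+0≤m₂
              (true⇒x⟶y h[j+1])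
              -- Since `n + e = k`, the row periods `n` and `k` together absorb the shift `e`.
              (false⇒y⟶x (begin
                a 1 (e + suc j)   ≡⟨ cong (a 1) (+-suc e j) ⟩
                a 1 (suc (e + j)) ≡⟨ diagonal 0 (e + j) ⟩
                a 0 (e + j)       ≡⟨ row-periodicₙ 0 (e + j) ⟨
                a 0 (n + (e + j)) ≡⟨ cong (a 0) n+e+j≡k+j ⟩
                a 0 (k + j)       ≡⟨ row-periodicₖ 0 j ⟩
                a 0 j             ≡⟨ h[j] ⟩
                false             ∎))
              (true⇒x⟶y (begin
                a (n₂ + 1) j             ≡⟨ diagonal (n₂ + 1) j ⟨
                a (suc (n₂ + 1)) (suc j) ≡⟨ cong (λ x → a x (suc j)) (cong suc (+-comm n₂ 1)) ⟩
                a n (suc j)              ≡⟨ col-wrap (suc j) ⟩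
                a 0 (suc j)              ≡⟨ h[j+1] ⟩
                true                     ∎))
              (false⇒y⟶x h[j]))
      where
      open ≡-Reasoning
      e = l ∸ n₂

      e+0≤m₂ : e + 0 ≤ m₂
      e+0≤m₂ = ≤-trans (≤-reflexive (+-identityʳ e)) (m≤n+o⇒m∸n≤o l n₂
        (≤-trans (n≤1+n l) (≤-trans (≤-reflexive (sym eq)) (+-mono-≤ p≤n₂ q≤m₂))))

      n+e+j≡k+j : n + (e + j) ≡ k + j
      n+e+j≡k+j = trans (sym (+-assoc n e j))
        (cong (_+ j) (trans (cong (2 +_) (m+[n∸m]≡n n₂≤l)) (cong suc (sym eq))))

  every-length : ∀ l → 3 ≤ l → l ≤ n + m → HasCycle D l
  every-length (suc (suc (suc l))) (s≤s (s≤s (s≤s z≤n))) 3+l≤n+m with m≤n⇒m<n∨m≡n 3+l≤n+m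
  ... | inj₂ 3+l≡n+m = subst (HasCycle D) (sym 3+l≡n+m) hamiltonian-cycle
  ... | inj₁ 3+l<n+m
    -- The bound `3 + l < n + m` amounts to `l ≤ n₂ + m₂`.
    with p , q , p≤n₂ , q≤m₂ , refl ← ≤-+-split {l} n₂ m₂ (s≤s⁻¹ (s≤s⁻¹
           (subst (2 + l ≤_) (trans (+-suc n₂ (suc m₂)) (cong suc (+-suc n₂ m₂))) (s≤s⁻¹ (s≤s⁻¹ 3+l<n+m)))))
    = short-cycle p q p≤n₂ q≤m₂

-- From Hamiltonian summands to tours in the sum.

hamiltonian⇒tour : ∀ {D} → Hamiltonian D →
  ∃ λ k → order D ≡ 2 + k × ∃ λ (X : Tour D (2 + k)) → ∀ v → ∃ λ i → Tour.at X i ≡ v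
hamiltonian⇒tour (C@record { last = zero } , _) = contradiction refl (last≢0 C)
hamiltonian⇒tour (C@record { last = suc k } , cover) =
  k , sym (spanning⇒length≡order C cover) , cycle⇒tour C , λ v → tour-covers C v (cover v)

module _ {D₁ D₂ D : Digraph} (D∈D₁⊕D₂ : D ∈ D₁ ⊕ D₂) where
  open _∈_⊕_ D∈D₁⊕D₂
  private module vertices = Inverse vertices

  to-injective : Injective _≡_ _≡_ vertices.to
  to-injective {u} {v} eq =
    trans (sym (vertices.strictlyInverseʳ u)) (trans (cong vertices.from eq) (vertices.strictlyInverseʳ v))

  sum-order : order D ≡ order D₁ + order D₂
  sum-order = ↔⇒≡ (↔-sym +↔⊎ ↔-∘ ((Digraph.finite D₁ ⊎-↔ Digraph.finite D₂)
                    ↔-∘ (↔-sym vertices ↔-∘ ↔-sym (Digraph.finite D))))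

  sum-pancyclic : Hamiltonian D₁ → Hamiltonian D₂ → Strong D → Pancyclic D
  sum-pancyclic H₁ H₂ strong
    with n₂ , n≡ , X , X-cover ← hamiltonian⇒tour H₁
    with m₂ , m≡ , Y , Y-cover ← hamiltonian⇒tour H₂
    = subst (3 ≤_) (sym order≡) (s≤s (s≤s (subst (1 ≤_) (sym (+-suc n₂ (suc m₂))) (s≤s z≤n)))) ,
      λ l 3≤l l≤ → every-length l 3≤l (subst (l ≤_) order≡ l≤)
    where
    order≡ : order D ≡ (2 + n₂) + (2 + m₂)
    order≡ = trans sum-order (cong₂ _+_ n≡ m≡)

    cover : ∀ v → (∃ λ s → ι₁ (Tour.at X s) ≡ v) ⊎ (∃ λ r → ι₂ (Tour.at Y r) ≡ v)
    cover v with vertices.from v | vertices.strictlyInverseˡ v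
    ... | inj₁ u | eq = inj₁ (proj₁ (X-cover u) , trans (cong ι₁ (proj₂ (X-cover u))) eq)
    ... | inj₂ u | eq = inj₂ (proj₁ (Y-cover u) , trans (cong ι₂ (proj₂ (Y-cover u))) eq)

    open StrongSum n₂ m₂
      (mapTour ι₁ (inj₁-injective ∘ to-injective) (Equivalence.to (induced₁ _ _)) X)
      (mapTour ι₂ (inj₂-injective ∘ to-injective) (Equivalence.to (induced₂ _ _)) Y)
      (λ s r eq → contradiction (to-injective eq) λ ())
      cover
      (λ s r → between _ _)
      strong

theorem34 : ∀ (D₁ D₂ D : Digraph) →
    let n   = order D₁
        m   = order D₂
        d   = gcd n m
        m/d = quotient (gcd[m,n]∣n n m)
    in
    Hamiltonian D₁ → Hamiltonian D₂ → n ≥ m →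
    D ∈ D₁ ⊕ D₂ → Strong D →
    VertexPancyclic D
    ⊎ Pancyclic D
    ⊎ (Hamiltonian D ×
       (∀ l → (3 ≤ l × l ≤ n + 1) ⊎ (∃ λ i → i < m/d × l ≡ n + i * d) → HasCycle D l))
theorem34 D₁ D₂ D H₁ H₂ _ D∈D₁⊕D₂ strong = inj₂ (inj₁ (sum-pancyclic D∈D₁⊕D₂ H₁ H₂ strong))
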